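{- Let $G$ be a $3$-connected graph in $\mathcal{G}_2$ that has a $5$-cycle. If every $3$-cutset of $G$ is a stable set, then $G$ contains two distinct $5$-cycles sharing at least one edge.
   Context: All graphs are finite and simple. A hole is an induced cycle of length at least $4$; an odd hole is a hole of odd length. $\mathcal{G}_2$ is the family of graphs of girth exactly $5$ having no odd holes of length at least $7$. A $3$-cutset is a set of $3$ vertices whose removal disconnects the graph; a set is stable if it induces no edges. -}

module Defs where

open import Data.Nat using (ℕ; zero; suc; _<_; _≤_)
open import Data.Nat.Properties using (≤-refl)
open import Data.Fin using (Fin; toℕ; fromℕ<)
open import Data.Nat.DivMod using (_%_; m%n<n)
open import Data.Fin.Subset using (Subset; _∈_; _∉_; ∣_∣)
open import Data.Bool using (Bool; true; false)
open import Data.Product using (Σ; ∃; _×_; _,_)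
open import Data.Sum using (_⊎_)
open import Data.Empty using (⊥)
open import Relation.Nullary using (¬_)
open import Relation.Binary.PropositionalEquality using (_≡_; _≢_)
open import Function.Definitions using (Injective)
open import Function.Bundles using (_⇔_)

record Graph (n : ℕ) : Set where
  field
    adj    : Fin n → Fin n → Bool
    sym    : ∀ u v → adj u v ≡ adj v u
    irrefl : ∀ u → adj u u ≡ false

module _ {n : ℕ} (G : Graph n) where
  open Graph G

  Adj : Fin n → Fin n → Set
  Adj u v = adj u v ≡ true

  next : {k : ℕ} → Fin k → Fin k
  next {suc k} i = fromℕ< (m%n<n (suc (toℕ i)) (suc k))

  record Cycle (k : ℕ) : Set where
    field
      len≥3 : 3 ≤ k
      vtx   : Fin k → Fin n
      inj   : Injective _≡_ _≡_ vtx
      edges : ∀ i → Adj (vtx i) (vtx (next i))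

  open Cycle public

  Induced : {k : ℕ} → Cycle k → Set
  Induced {k} C = ∀ i j → Adj (vtx C i) (vtx C j) → (j ≡ next i) ⊎ (i ≡ next j)

  Hole : ℕ → Set
  Hole k = 4 ≤ k × Σ (Cycle k) Induced

  Girth5 : Set
  Girth5 = Cycle 5 × (∀ k → k < 5 → ¬ Cycle k)

  NoLongOddHole : Set
  NoLongOddHole = ∀ k → 7 ≤ k → Odd k → ¬ Hole k
    where
    Odd : ℕ → Set
    Odd m = ∃ λ t → m ≡ suc (t Data.Nat.+ t)

  InG2 : Set
  InG2 = Girth5 × NoLongOddHole

  data WalkAvoiding (X : Subset n) : Fin n → Fin n → Set where
    here : ∀ {u} → u ∉ X → WalkAvoiding X u u
    step : ∀ {u v w} → u ∉ X → Adj u v → WalkAvoiding X v w → WalkAvoiding X u w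

  ConnectedWithout : Subset n → Set
  ConnectedWithout X = ∀ u v → u ∉ X → v ∉ X → WalkAvoiding X u v

  ThreeConnected : Set
  ThreeConnected = 3 < n × (∀ (X : Subset n) → ∣ X ∣ < 3 → ConnectedWithout X)

  ThreeCutset : Subset n → Set
  ThreeCutset S = ∣ S ∣ ≡ 3 × ¬ ConnectedWithout S

  Stable : Subset n → Set
  Stable S = ∀ u v → u ∈ S → v ∈ S → ¬ Adj u v

  EdgeOf : {k : ℕ} → Cycle k → Fin n → Fin n → Set
  EdgeOf {k} C u v = ∃ λ (i : Fin k) →
    (vtx C i ≡ u × vtx C (next i) ≡ v) ⊎ (vtx C i ≡ v × vtx C (next i) ≡ u)

  SameCycle : {k l : ℕ} → Cycle k → Cycle l → Set
  SameCycle C D = ∀ u v → EdgeOf C u v ⇔ EdgeOf D u v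

  TwoFiveCyclesSharingEdge : Set
  TwoFiveCyclesSharingEdge =
    Σ (Cycle 5) λ C → Σ (Cycle 5) λ D →
      ¬ SameCycle C D × (∃ λ u → ∃ λ v → EdgeOf C u v × EdgeOf D u v)

{-# OPTIONS --safe #-}
module Submission where

-- Suppose that no two pentagons share an edge. Fix a pentagon c0 … c4 and let A_i be the
-- set of neighbours of c_i off the pentagon; by girth 5 these sets are disjoint.
--
-- Separation: off the pentagon, every walk from A_{i-1} to A_{i+1} meets A_i. Otherwise take
-- an induced path from A_0 to A_2 avoiding A_1. Closing it up through c0 c1 c2 gives a hole,
-- so its length is even. On the other hand, segments of the path with ends in A_i ∪ A_j and
-- suitable interior close up through part of the pentagon to holes, which fixes their
-- parities; reading the labels 0, 4, …, 3, 2 from left to right, they force an odd length.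
--
-- Since unstable 3-sets do not disconnect G, from any vertex off the pentagon there is a walk
-- off the pentagon to A_i ∪ A_{i+1}, for every i, meeting that set only at its end. Starting
-- in A_0, reach A_2 ∪ A_3, say A_2, and from there A_3 ∪ A_4: reaching A_4 joins A_2 to A_4
-- avoiding A_3, and reaching A_3 joins A_0 to A_3 avoiding A_4 (unless the first walk already
-- joins A_4 to A_2 avoiding A_3), against separation.

open import Defs
open import Data.Bool using (true)
import Data.Bool.Properties as Bool
open import Data.Empty using (⊥; ⊥-elim)
open import Data.Fin using (Fin; zero; suc; toℕ)
open import Data.Fin.Properties using (toℕ-injective; toℕ-fromℕ<; toℕ<n; any?; _≟_)
open import Data.Fin.Subset using (Subset; _∉_; _∪_; ⁅_⁆; ∣_∣; inside; outside)
open import Data.Fin.Subset.Properties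
  using (∪-identityˡ; ∣⁅x⁆∣≡1; x∈⁅x⁆; x∈⁅y⁆⇒x≡y; x∈p∪q⁺; x∈p∪q⁻)
open import Data.Nat using (ℕ; zero; suc; _+_; _∸_; _≤_; _<_; z≤n; s≤s; z<s; parity)
open import Data.Nat.DivMod using (_%_; m<n⇒m%n≡m; n%n≡0)
open import Data.Nat.Properties
  using (≤-refl; ≤-trans; ≤-reflexive; ≤-pred; <-trans; <⇒≤; <-irrefl; <-≤-trans; ≤-<-trans; <-cmp;
         m≤n⇒m<n∨m≡n; m≤n⇒m≤1+n; m∸n+n≡m; +-suc; +-monoˡ-≤; +-monoˡ-<)
import Data.Nat.Properties as ℕ
open import Data.Parity.Base as ℙ using (0ℙ; 1ℙ; _⁻¹)
open import Data.Parity.Properties using (+-homo-+; suc-homo-⁻¹)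
open import Data.Product using (∃; _×_; _,_; proj₁; proj₂)
open import Data.Sum using (_⊎_; inj₁; inj₂)
open import Data.Vec using ([]; _∷_; lookup; here; there)
open import Data.Vec.Relation.Unary.All using ([]; _∷_)
open import Data.Vec.Relation.Unary.AllPairs using ([]; _∷_)
open import Data.Vec.Relation.Unary.Unique.Propositional.Properties using (lookup-injective)
open import Function using (_∘_)
open import Function.Bundles using (Equivalence)
open import Relation.Binary.Definitions using (tri<; tri≈; tri>)
open import Relation.Binary.PropositionalEquality
  using (_≡_; _≢_; refl; sym; trans; cong; subst; subst₂; ≢-sym)
open import Relation.Nullary using (¬_; Dec; yes; no; ¬?; _×-dec_; _⊎-dec_; contradiction)

-- Parity, bounded search on naturals, sizes of small vertex sets.

odd⇒double+1 : ∀ m → parity m ≡ 1ℙ → ∃ λ t → m ≡ suc (t + t)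
odd⇒double+1 1 _ = 0 , refl
odd⇒double+1 (suc (suc m)) odd with odd⇒double+1 m odd
... | t , refl = suc t , cong (λ r → suc (suc r)) (sym (+-suc t t))

parity-∸ : ∀ {i k} → i ≤ k → parity k ≡ parity (k ∸ i) ℙ.+ parity i
parity-∸ {i} {k} i≤k = trans (cong parity (sym (m∸n+n≡m i≤k))) (+-homo-+ (k ∸ i) i)

last : {P : ℕ → Set} → (∀ t → Dec (P t)) → ∀ p → P 0 →
       ∃ λ i → i ≤ p × P i × (∀ t → i < t → t ≤ p → ¬ P t)
last P? zero P0 = 0 , z≤n , P0 , λ { (suc t) _ () }
last {P} P? (suc p) P0 with P? (suc p)
... | yes Pp = suc p , ≤-refl , Pp , λ t p<t t≤p → ⊥-elim (<-irrefl refl (<-≤-trans p<t t≤p))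
... | no ¬Pp with last P? p P0
...   | i , i≤p , Pi , above = i , m≤n⇒m≤1+n i≤p , Pi , above′
  where
  above′ : ∀ t → i < t → t ≤ suc p → ¬ P t
  above′ t i<t t≤ with m≤n⇒m<n∨m≡n t≤
  ... | inj₁ t<  = above t i<t (≤-pred t<)
  ... | inj₂ refl = ¬Pp

first : {P : ℕ → Set} → (∀ t → Dec (P t)) → ∀ p → P p →
        ∃ λ k → k ≤ p × P k × (∀ t → t < k → ¬ P t)
first P? zero Pp = 0 , z≤n , Pp , λ _ ()
first {P} P? (suc p) Pp with P? 0
... | yes P0 = 0 , z≤n , P0 , λ _ ()
... | no ¬P0 with first (P? ∘ suc) p Pp
...   | k , k≤p , Pk , below = suc k , s≤s k≤p , Pk , λ
        { zero _ → ¬P0 ; (suc t) (s≤s t<k) → below t t<k }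

below : ∀ {P : ℕ → Set} {i j} → (∀ t → i < t → t ≤ j → P t) → ∀ t → i < t → t < suc j → P t
below P t i<t t≤j = P t i<t (≤-pred t≤j)

extend : ∀ {P : ℕ → Set} {i j} → (∀ t → i < t → t ≤ j → P t) → P (suc j) →
         ∀ t → i < t → t ≤ suc j → P t
extend old new t i<t t≤ with m≤n⇒m<n∨m≡n t≤
... | inj₁ t<  = old t i<t (≤-pred t<)
... | inj₂ refl = new

∣⁅x⁆∪p∣ : ∀ {n} {x : Fin n} (p : Subset n) → x ∉ p → ∣ ⁅ x ⁆ ∪ p ∣ ≡ suc ∣ p ∣
∣⁅x⁆∪p∣ {x = zero}  (inside  ∷ p) x∉p = ⊥-elim (x∉p here)
∣⁅x⁆∪p∣ {x = zero}  (outside ∷ p) x∉p = cong (suc ∘ ∣_∣) (∪-identityˡ p)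
∣⁅x⁆∪p∣ {x = suc x} (inside  ∷ p) x∉p = cong suc (∣⁅x⁆∪p∣ p (x∉p ∘ there))
∣⁅x⁆∪p∣ {x = suc x} (outside ∷ p) x∉p = ∣⁅x⁆∪p∣ p (x∉p ∘ there)

-- Induced paths, and the holes obtained by closing them up.

module InducedPaths {n : ℕ} (G : Graph n) where
  open Graph G using (adj; irrefl)

  V : Set
  V = Fin n

  infix 4 _~_ _~?_

  _~_ : V → V → Set
  _~_ = Adj G

  _~?_ : ∀ u v → Dec (u ~ v)
  u ~? v = adj u v Bool.≟ true

  ~-sym : ∀ {u v} → u ~ v → v ~ u
  ~-sym {u} {v} u~v = trans (Graph.sym G v u) u~v

  ~⇒≢ : ∀ {u v} → u ~ v → u ≢ v
  ~⇒≢ {u} u~u refl with trans (sym u~u) (irrefl u)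
  ... | ()

  Apart : V → V → Set
  Apart u v = u ≢ v × ¬ u ~ v

  Apart-sym : ∀ {u v} → Apart u v → Apart v u
  Apart-sym (u≢v , u≁v) = ≢-sym u≢v , u≁v ∘ ~-sym

  -- An induced path is f 0, …, f p; the values of f beyond p are junk.
  record InducedPath (f : ℕ → V) (p : ℕ) : Set where
    field
      link : ∀ t → t < p → f t ~ f (suc t)
      far  : ∀ s t → suc s < t → t ≤ p → Apart (f s) (f t)
  open InducedPath

  infixr 5 _◂_
  _◂_ : V → (ℕ → V) → ℕ → V
  (v ◂ f) zero    = v
  (v ◂ f) (suc t) = f t

  cons : ∀ {f p v} → InducedPath f p → v ~ f 0 →
         (∀ t → 0 < t → t ≤ p → Apart v (f t)) → InducedPath (v ◂ f) (suc p)
  cons F v~f0 apart .link zero    _         = v~f0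
  cons F v~f0 apart .link (suc t) (s≤s t<p) = F .link t t<p
  cons F v~f0 apart .far zero    (suc t) (s≤s 0<t) (s≤s t≤p) = apart t 0<t t≤p
  cons F v~f0 apart .far (suc s) (suc t) (s≤s s<t) (s≤s t≤p) = F .far s t s<t t≤p

  truncate : ∀ {f p q} → q ≤ p → InducedPath f p → InducedPath f q
  truncate q≤p F .link t t<q = F .link t (<-≤-trans t<q q≤p)
  truncate q≤p F .far s t s<t t≤q = F .far s t s<t (≤-trans t≤q q≤p)

  ∸-bound : ∀ {i p t} → i ≤ p → t ≤ p ∸ i → t + i ≤ p
  ∸-bound {i} {p} {t} i≤p t≤ = ≤-trans (+-monoˡ-≤ i t≤) (≤-reflexive (m∸n+n≡m i≤p))

  drop : ∀ {f p i} → i ≤ p → InducedPath f p → InducedPath (λ t → f (t + i)) (p ∸ i)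
  drop {i = i} i≤p F .link t t< = F .link (t + i) (∸-bound i≤p t<)
  drop {i = i} i≤p F .far s t s<t t≤ =
    F .far (s + i) (t + i) (+-monoˡ-≤ i s<t) (∸-bound i≤p t≤)

  -- The disjunction in `apart` exempts only the pair `0`, `suc q`, which is the closing edge. There
  -- are `suc (suc q)` vertices, so `2 ≤ q` gives the length 4 that a hole needs.
  module _ (F : ℕ → V) (q : ℕ) (2≤q : 2 ≤ q)
           (steps : ∀ t → t < suc q → F t ~ F (suc t))
           (close : F (suc q) ~ F 0)
           (apart : ∀ s t → suc s < t → t ≤ suc q → s ≢ 0 ⊎ t ≢ suc q → Apart (F s) (F t))
           where

    next-cases : ∀ (i : Fin (suc (suc q))) →
      (toℕ i < suc q × toℕ (next G i) ≡ suc (toℕ i)) ⊎ (toℕ i ≡ suc q × toℕ (next G i) ≡ 0)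
    next-cases i with m≤n⇒m<n∨m≡n (≤-pred (toℕ<n i))
    ... | inj₁ i<  = inj₁ (i< , trans (toℕ-fromℕ< _) (m<n⇒m%n≡m (s≤s i<)))
    ... | inj₂ eq = inj₂ (eq , trans (toℕ-fromℕ< _)
            (trans (cong (λ t → suc t % suc (suc q)) eq) (n%n≡0 (suc (suc q)))))

    order : ∀ s t → s < t → t ≤ suc q →
            t ≡ suc s ⊎ (s ≡ 0 × t ≡ suc q) ⊎ Apart (F s) (F t)
    order s t s<t t≤ with m≤n⇒m<n∨m≡n s<t
    ... | inj₂ eq = inj₁ (sym eq)
    ... | inj₁ ss<t with s ℕ.≟ 0 | t ℕ.≟ suc q
    ...   | yes s0 | yes tq = inj₂ (inj₁ (s0 , tq))
    ...   | no  s≢ | _      = inj₂ (inj₂ (apart s t ss<t t≤ (inj₁ s≢)))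
    ...   | _      | no  t≢ = inj₂ (inj₂ (apart s t ss<t t≤ (inj₂ t≢)))

    distinct : ∀ s t → s < t → t ≤ suc q → F s ≢ F t
    distinct s t s<t t≤ with order s t s<t t≤
    ... | inj₁ refl                 = ~⇒≢ (steps s t≤)
    ... | inj₂ (inj₁ (refl , refl)) = ≢-sym (~⇒≢ close)
    ... | inj₂ (inj₂ (≢ , _))       = ≢

    forward : ∀ i j → toℕ i < toℕ j → F (toℕ i) ~ F (toℕ j) → j ≡ next G i ⊎ i ≡ next G j
    forward i j i<j i~j with order (toℕ i) (toℕ j) i<j (≤-pred (toℕ<n j)) | next-cases i | next-cases j
    ... | inj₂ (inj₂ (_ , ≁)) | _ | _ = contradiction i~j ≁
    ... | inj₁ eq | inj₁ (_ , nx) | _ = inj₁ (toℕ-injective (trans eq (sym nx)))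
    ... | inj₁ eq | inj₂ (i≡ , _) | _ = ⊥-elim (<-irrefl (trans eq (cong suc i≡)) (toℕ<n j))
    ... | inj₂ (inj₁ (i≡ , j≡)) | _ | inj₂ (_ , nx) = inj₂ (toℕ-injective (trans i≡ (sym nx)))
    ... | inj₂ (inj₁ (i≡ , j≡)) | _ | inj₁ (j< , _) = ⊥-elim (<-irrefl j≡ j<)

    loopHole : Hole G (suc (suc q))
    loopHole = s≤s (s≤s 2≤q) , C , induced
      where
      injective : ∀ {i j : Fin (suc (suc q))} → F (toℕ i) ≡ F (toℕ j) → i ≡ j
      injective {i} {j} eq with <-cmp (toℕ i) (toℕ j)
      ... | tri≈ _ i≡j _ = toℕ-injective i≡j
      ... | tri< i<j _ _ = contradiction eq (distinct _ _ i<j (≤-pred (toℕ<n j)))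
      ... | tri> _ _ j<i = contradiction (sym eq) (distinct _ _ j<i (≤-pred (toℕ<n i)))
      edge : ∀ i → F (toℕ i) ~ F (toℕ (next G i))
      edge i with next-cases i
      ... | inj₁ (i< , nx) = subst (λ t → F (toℕ i) ~ F t) (sym nx) (steps (toℕ i) i<)
      ... | inj₂ (i≡ , nx) = subst₂ (λ s t → F s ~ F t) (sym i≡) (sym nx) close
      C : Cycle G (suc (suc q))
      C = record { len≥3 = s≤s (s≤s (≤-trans (s≤s z≤n) 2≤q)) ; vtx = F ∘ toℕ
                 ; inj = injective ; edges = edge }
      induced : Induced G C
      induced i j i~j with <-cmp (toℕ i) (toℕ j)
      ... | tri< i<j _ _ = forward i j i<j i~j
      ... | tri≈ _ i≡j _ = contradiction (cong F i≡j) (~⇒≢ i~j)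
      ... | tri> _ _ j<i with forward j i j<i (~-sym i~j)
      ...   | inj₁ eq = inj₂ eq
      ...   | inj₂ eq = inj₁ eq

  -- Only the interior is subject to `P`: the ends are the vertices through which an arc gets
  -- attached to the pentagon. The length is an index because its parity is what the argument is
  -- about.
  record Arc (P : V → Set) (x y : V) (m : ℕ) : Set where
    field
      at    : ℕ → V
      path  : InducedPath at m
      start : at 0 ≡ x
      end   : at m ≡ y
      inner : ∀ t → 0 < t → t < m → P (at t)
  open Arc

  subarc : ∀ {P f p i k} → InducedPath f p → i ≤ k → k ≤ p →
           (∀ t → i < t → t < k → P (f t)) → Arc P (f i) (f k) (k ∸ i)
  subarc {f = f} {i = i} {k} F i≤k k≤p inn = record
    { at    = λ t → f (t + i)
    ; path  = drop i≤k (truncate k≤p F)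
    ; start = refl
    ; end   = cong f (m∸n+n≡m i≤k)
    ; inner = λ t 0<t t< → inn (t + i) (+-monoˡ-< i 0<t) (∸-bound i≤k t<)
    }

  -- The old start becomes interior, hence `z ≡ x ⊎ P z`. Iterating this adds pentagon vertices one
  -- by one; `closeHole` then adds the last.
  prepend : ∀ {P x y m v} → Arc P x y m → v ~ x → Apart v y →
            (∀ {z} → P z → Apart v z) → Arc (λ z → z ≡ x ⊎ P z) v y (suc m)
  prepend {P} {x} {y} {m} {v} A v~x v#y v#P = record
    { at    = v ◂ at A
    ; path  = cons (path A) (subst (v ~_) (sym (start A)) v~x) apart
    ; start = refl
    ; end   = end A
    ; inner = λ { (suc zero) _ _ → inj₁ (start A)
                ; (suc (suc t)) _ (s≤s t<) → inj₂ (inner A (suc t) z<s t<) }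
    }
    where
    apart : ∀ t → 0 < t → t ≤ m → Apart v (at A t)
    apart t 0<t t≤m with m≤n⇒m<n∨m≡n t≤m
    ... | inj₁ t<m  = v#P (inner A t 0<t t<m)
    ... | inj₂ refl = subst (Apart v) (sym (end A)) v#y

  closeHole : ∀ {P x y m w} → Arc P x y m → 2 ≤ m → w ~ x → w ~ y →
              (∀ {z} → P z → Apart w z) → Hole G (suc (suc m))
  closeHole {P} {x} {y} {m} {w} A 2≤m w~x w~y w#P =
    loopHole (w ◂ at A) m 2≤m steps (subst (_~ w) (sym (end A)) (~-sym w~y)) apart
    where
    steps : ∀ t → t < suc m → (w ◂ at A) t ~ (w ◂ at A) (suc t)
    steps zero    _         = subst (w ~_) (sym (start A)) w~x
    steps (suc t) (s≤s t<m) = path A .link t t<m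
    apart : ∀ s t → suc s < t → t ≤ suc m → s ≢ 0 ⊎ t ≢ suc m → Apart ((w ◂ at A) s) ((w ◂ at A) t)
    apart (suc s) (suc t) (s≤s s<t) (s≤s t≤m) _ = path A .far s t s<t t≤m
    apart zero (suc t) _ _ (inj₁ 0≢0) = contradiction refl 0≢0
    apart zero (suc t) (s≤s 0<t) (s≤s t≤m) (inj₂ t≢m) with m≤n⇒m<n∨m≡n t≤m
    ... | inj₁ t<m  = w#P (inner A t 0<t t<m)
    ... | inj₂ refl = contradiction refl t≢m

  data Walk (P : V → Set) : V → V → Set where
    here : ∀ {u} → P u → Walk P u u
    step : ∀ {u v w} → P u → u ~ v → Walk P v w → Walk P u w

  mapWalk : ∀ {P Q x y} → (∀ {z} → P z → Q z) → Walk P x y → Walk Q x y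
  mapWalk f (here Pu)      = here (f Pu)
  mapWalk f (step Pu e w)  = step (f Pu) e (mapWalk f w)

  endpoint : ∀ {P x y} → Walk P x y → P y
  endpoint (here Py)    = Py
  endpoint (step _ _ w) = endpoint w

  append : ∀ {P x y z} → Walk P x y → Walk P y z → Walk P x z
  append (here _)      w′ = w′
  append (step Pu e w) w′ = step Pu e (append w w′)

  avoidOrMeet : ∀ {P Q : V → Set} {x y} → (∀ z → Dec (Q z)) → Walk P x y →
                Walk (λ z → P z × ¬ Q z) x y ⊎ ∃ λ z → Q z × Walk P z y
  avoidOrMeet Q? (here {u} Pu) with Q? u
  ... | yes Qu = inj₂ (u , Qu , here Pu)
  ... | no ¬Qu = inj₁ (here (Pu , ¬Qu))
  avoidOrMeet Q? (step {u} Pu e w) with Q? u | avoidOrMeet Q? w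
  ... | yes Qu | _       = inj₂ (u , Qu , step Pu e w)
  ... | no _   | inj₂ m  = inj₂ m
  ... | no ¬Qu | inj₁ w′ = inj₁ (step (Pu , ¬Qu) e w′)

  record Shortcut (P : V → Set) (x y : V) : Set where
    field
      len    : ℕ
      at     : ℕ → V
      path   : InducedPath at len
      start  : at 0 ≡ x
      end    : at len ≡ y
      within : ∀ t → t ≤ len → P (at t)

  -- Induction on the walk: the rest is already an induced path `f`, and it is cut at its last
  -- vertex equal or adjacent to `u`. If equal, the tail serves; if adjacent, `u` is put in front of
  -- it. The search succeeds because `u` is adjacent to `f 0`.
  shorten : ∀ {P x y} → Walk P x y → Shortcut P x y
  shorten (here {u} Pu) = record
    { len = 0 ; at = λ _ → u ; path = record { link = λ _ () ; far = λ { _ _ () z≤n } }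
    ; start = refl ; end = refl ; within = λ _ _ → Pu }
  shorten {P} {x} {y} (step {u} Pu u~v w) with shorten w
  ... | record { len = p ; at = f ; path = F ; start = st ; end = en ; within = inP }
    with last (λ t → (u ≟ f t) ⊎-dec (u ~? f t)) p (inj₂ (subst (u ~_) (sym st) u~v))
  ...   | i , i≤p , inj₁ u≡fi , _ = record
          { len = p ∸ i ; at = λ t → f (t + i) ; path = drop i≤p F
          ; start = sym u≡fi ; end = trans (cong f (m∸n+n≡m i≤p)) en
          ; within = λ t t≤ → inP (t + i) (∸-bound i≤p t≤) }
  ...   | i , i≤p , inj₂ u~fi , above = record
          { len = suc (p ∸ i) ; at = u ◂ λ t → f (t + i)
          ; path = cons (drop i≤p F) u~fi λ t 0<t t≤ →
              let none = above (t + i) (+-monoˡ-< i 0<t) (∸-bound i≤p t≤)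
              in none ∘ inj₁ , none ∘ inj₂
          ; start = refl ; end = trans (cong f (m∸n+n≡m i≤p)) en
          ; within = λ { zero _ → Pu ; (suc t) (s≤s t≤) → inP (t + i) (∸-bound i≤p t≤) } }


-- Pentagons and their outside neighbours without triangles and squares.

module Pentagons {n : ℕ} (G : Graph n) (girth : ∀ k → k < 5 → ¬ Cycle G k) where
  open InducedPaths G

  noTriangle : ∀ {a b c} → a ~ b → b ~ c → c ~ a → ⊥
  noTriangle {a} {b} {c} ab bc ca = girth 3 (ℕ.m≤m+n 4 1) record
    { len≥3 = ≤-refl
    ; vtx   = lookup (a ∷ b ∷ c ∷ [])
    ; inj   = lookup-injective ((~⇒≢ ab ∷ ≢-sym (~⇒≢ ca) ∷ []) ∷ (~⇒≢ bc ∷ []) ∷ [] ∷ []) _ _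
    ; edges = λ { zero → ab ; (suc zero) → bc ; (suc (suc zero)) → ca }
    }

  noSquare : ∀ {a b c d} → a ≢ c → b ≢ d → a ~ b → b ~ c → c ~ d → d ~ a → ⊥
  noSquare {a} {b} {c} {d} a≢c b≢d ab bc cd da = girth 4 ≤-refl record
    { len≥3 = ℕ.m≤m+n 3 1
    ; vtx   = lookup (a ∷ b ∷ c ∷ d ∷ [])
    ; inj   = lookup-injective ((~⇒≢ ab ∷ a≢c ∷ ≢-sym (~⇒≢ da) ∷ []) ∷ (~⇒≢ bc ∷ b≢d ∷ [])
                                ∷ (~⇒≢ cd ∷ []) ∷ [] ∷ []) _ _
    ; edges = λ { zero → ab ; (suc zero) → bc ; (suc (suc zero)) → cd
                ; (suc (suc (suc zero))) → da }
    }

  -- Distinctness of the five vertices follows from the absence of triangles.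
  record Pentagon (a b c d e : V) : Set where
    constructor pentagon
    field
      ab : a ~ b
      bc : b ~ c
      cd : c ~ d
      de : d ~ e
      ea : e ~ a

  rotate : ∀ {a b c d e} → Pentagon a b c d e → Pentagon b c d e a
  rotate (pentagon ab bc cd de ea) = pentagon bc cd de ea ab

  reflect : ∀ {a b c d e} → Pentagon a b c d e → Pentagon a e d c b
  reflect (pentagon ab bc cd de ea) =
    pentagon (~-sym ea) (~-sym de) (~-sym cd) (~-sym bc) (~-sym ab)

  diagonal : ∀ {a b c d e} → Pentagon a b c d e → Apart a c
  diagonal (pentagon ab bc cd de ea) =
    (λ { refl → noTriangle cd de ea }) , λ ac → noTriangle ab bc (~-sym ac)

  toCycle : ∀ {a b c d e} → Pentagon a b c d e → Cycle G 5
  toCycle {a} {b} {c} {d} {e} p@(pentagon ab bc cd de ea) = record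
    { len≥3 = ℕ.m≤m+n 3 2
    ; vtx   = lookup (a ∷ b ∷ c ∷ d ∷ e ∷ [])
    ; inj   = lookup-injective
        ((~⇒≢ ab ∷ proj₁ (diagonal p) ∷ proj₁ (diagonal (reflect p)) ∷ ≢-sym (~⇒≢ ea) ∷ [])
        ∷ (~⇒≢ bc ∷ proj₁ (diagonal (rotate p)) ∷ proj₁ (diagonal (reflect (rotate p))) ∷ [])
        ∷ (~⇒≢ cd ∷ proj₁ (diagonal (rotate (rotate p))) ∷ []) ∷ (~⇒≢ de ∷ []) ∷ [] ∷ []) _ _
    ; edges = λ { zero → ab ; (suc zero) → bc ; (suc (suc zero)) → cd
                ; (suc (suc (suc zero))) → de ; (suc (suc (suc (suc zero)))) → ea }
    }

  fromCycle : (C : Cycle G 5) →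
    Pentagon (vtx C zero) (vtx C (suc zero)) (vtx C (suc (suc zero)))
             (vtx C (suc (suc (suc zero)))) (vtx C (suc (suc (suc (suc zero)))))
  fromCycle C = pentagon (edges C _) (edges C _) (edges C _) (edges C _) (edges C _)

  Turn : V → V → V → Set
  Turn a b c = ∃ λ d → ∃ λ e → Pentagon a b c d e

  pentagon? : ∀ a b c d e → Dec (Pentagon a b c d e)
  pentagon? a b c d e with a ~? b | b ~? c | c ~? d | d ~? e | e ~? a
  ... | yes ab | yes bc | yes cd | yes de | yes ea = yes (pentagon ab bc cd de ea)
  ... | no ¬ab | _ | _ | _ | _ = no (¬ab ∘ Pentagon.ab)
  ... | _ | no ¬bc | _ | _ | _ = no (¬bc ∘ Pentagon.bc)
  ... | _ | _ | no ¬cd | _ | _ = no (¬cd ∘ Pentagon.cd)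
  ... | _ | _ | _ | no ¬de | _ = no (¬de ∘ Pentagon.de)
  ... | _ | _ | _ | _ | no ¬ea = no (¬ea ∘ Pentagon.ea)

  turn? : ∀ a b c → Dec (Turn a b c)
  turn? a b c = any? λ d → any? λ e → pentagon? a b c d e

  -- Two pentagons that share an edge and then diverge. In this form the question is a finite
  -- search, and a negative answer says that two consecutive vertices of a pentagon determine the
  -- next one, which is how the parity lemmas use it.
  TwoTurns : Set
  TwoTurns = ∃ λ a → ∃ λ b → ∃ λ c → ∃ λ c′ → Turn a b c × Turn a b c′ × c ≢ c′

  twoTurns? : Dec TwoTurns
  twoTurns? = any? λ a → any? λ b → any? λ c → any? λ c′ →
    turn? a b c ×-dec turn? a b c′ ×-dec ¬? (c ≟ c′)

  twoTurns⇒sharing : TwoTurns → TwoFiveCyclesSharingEdge G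
  twoTurns⇒sharing (a , b , c , c′ , (d , e , p) , (d′ , e′ , p′) , c≢c′) =
    toCycle p , toCycle p′ , different ,
    a , b , (zero , inj₁ (refl , refl)) , (zero , inj₁ (refl , refl))
    where
    different : ¬ SameCycle G (toCycle p) (toCycle p′)
    -- The edge `b c` tells the cycles apart: on the second pentagon the neighbours of `b` are `a`
    -- and `c′`.
    different same with Equivalence.to (same b c) (suc zero , inj₁ (refl , refl))
    ... | zero , inj₁ (a≡b , _) = ~⇒≢ (Pentagon.ab p) a≡b
    ... | zero , inj₂ (a≡c , _) = proj₁ (diagonal p) a≡c
    ... | suc zero , inj₁ (_ , c′≡c) = c≢c′ (sym c′≡c)
    ... | suc zero , inj₂ (b≡c , _) = ~⇒≢ (Pentagon.bc p) b≡c
    ... | suc (suc zero) , inj₁ (c′≡b , _) = ~⇒≢ (Pentagon.bc p′) (sym c′≡b)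
    ... | suc (suc zero) , inj₂ (_ , d′≡b) = proj₁ (diagonal (rotate p′)) (sym d′≡b)
    ... | suc (suc (suc zero)) , inj₁ (d′≡b , _) = proj₁ (diagonal (rotate p′)) (sym d′≡b)
    ... | suc (suc (suc zero)) , inj₂ (_ , e′≡b) = proj₁ (diagonal (reflect (rotate p′))) (sym e′≡b)
    ... | suc (suc (suc (suc zero))) , inj₁ (e′≡b , _) = proj₁ (diagonal (reflect (rotate p′))) (sym e′≡b)
    ... | suc (suc (suc (suc zero))) , inj₂ (_ , a≡b) = ~⇒≢ (Pentagon.ab p) a≡b

  record Outside (a b c d e x : V) : Set where
    constructor out
    field
      ≢a : x ≢ a
      ≢b : x ≢ b
      ≢c : x ≢ c
      ≢d : x ≢ d
      ≢e : x ≢ e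

  rotateOut : ∀ {a b c d e x} → Outside a b c d e x → Outside b c d e a x
  rotateOut (out a b c d e) = out b c d e a

  reflectOut : ∀ {a b c d e x} → Outside a b c d e x → Outside a e d c b x
  reflectOut (out a b c d e) = out a e d c b

  apart : ∀ {w z} → z ≢ w → ¬ z ~ w → Apart w z
  apart z≢w z≁w = ≢-sym z≢w , z≁w ∘ ~-sym

  -- A second neighbour of `x` on the pentagon would close a triangle if next to `a`, and a square
  -- if at distance two from `a`; the cases `d` and `e` mirror `c` and `b`. Hence an outside vertex
  -- carries at most one label.
  apart-b : ∀ {a b c d e x} → Pentagon a b c d e → Outside a b c d e x → x ~ a → Apart b x
  apart-b p o xa = apart (Outside.≢b o) λ xb → noTriangle xa (Pentagon.ab p) (~-sym xb)

  apart-c : ∀ {a b c d e x} → Pentagon a b c d e → Outside a b c d e x → x ~ a → Apart c x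
  apart-c p o xa = apart (Outside.≢c o) λ xc →
    noSquare (Outside.≢b o) (proj₁ (diagonal p)) xa (Pentagon.ab p) (Pentagon.bc p) (~-sym xc)

  apart-d : ∀ {a b c d e x} → Pentagon a b c d e → Outside a b c d e x → x ~ a → Apart d x
  apart-d p o = apart-c (reflect p) (reflectOut o)

  apart-e : ∀ {a b c d e x} → Pentagon a b c d e → Outside a b c d e x → x ~ a → Apart e x
  apart-e p o = apart-b (reflect p) (reflectOut o)

  -- Parities of arcs attached to a pentagon.

  module Parities (noLong : NoLongOddHole G)
                  (unique : ∀ {a b c c′} → Turn a b c → Turn a b c′ → c ≡ c′) where

    longHole-even : ∀ k → 7 ≤ k → Hole G k → parity k ≡ 0ℙ
    longHole-even k 7≤k hole with parity k in eq
    ... | 0ℙ = refl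
    ... | 1ℙ = ⊥-elim (noLong k 7≤k (odd⇒double+1 k eq) hole)

    suc-even : ∀ m → parity (suc m) ≡ 0ℙ → parity m ≡ 1ℙ
    suc-even m eq = trans (sym (suc-homo-⁻¹ m)) (cong _⁻¹ eq)

    7≤7+ : ∀ m → 7 ≤ 7 + m
    7≤7+ = ℕ.m≤m+n 7

    -- Closing through `w` gives a hole of length `m + 2`, which is long unless `m` is 4, itself
    -- even. The bound cannot drop to 3: such an arc closes to a pentagon.
    sameEnds-even : ∀ {P x y w} m → 4 ≤ m → Arc P x y m → x ~ w → y ~ w →
                    (∀ {z} → P z → Apart w z) → parity m ≡ 0ℙ
    sameEnds-even 4 _ _ _ _ _ = refl
    sameEnds-even m@(suc (suc (suc (suc (suc k))))) _ A xw yw w# =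
      longHole-even (2 + m) (7≤7+ k) (closeHole A (s≤s (s≤s z≤n)) (~-sym xw) (~-sym yw) w#)
    sameEnds-even 0 () _ _ _ _
    sameEnds-even 1 (s≤s ()) _ _ _ _
    sameEnds-even 2 (s≤s (s≤s ())) _ _ _ _
    sameEnds-even 3 (s≤s (s≤s (s≤s ()))) _ _ _ _

    module _ {P : V → Set} {a b c d e x y : V} (p : Pentagon a b c d e)
             (ox : Outside a b c d e x) (oy : Outside a b c d e y) where
      open Pentagon p

      arc₀ : Arc P x y 0 → x ≡ y
      arc₀ A = trans (sym (Arc.start A)) (Arc.end A)

      arc₁ : Arc P x y 1 → x ~ y
      arc₁ A = subst₂ _~_ (Arc.start A) (Arc.end A) (InducedPath.link (Arc.path A) 0 z<s)

      -- Closing through `a` and `b` gives a hole of length `m + 3`. Lengths 0, 1 and 2 would give a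
      -- triangle, a square and a second pentagon on `a b`. The bound `3 ≤ m` is returned because it
      -- later supplies the length required by `sameEnds-even`.
      adjacentEnds-odd : ∀ m → Arc P x y m → x ~ a → y ~ b →
        (∀ {z} → P z → Apart a z) → (∀ {z} → P z → Apart b z) → parity m ≡ 1ℙ × 3 ≤ m
      adjacentEnds-odd 0 A xa yb _ _ with arc₀ A
      ... | refl = contradiction (~-sym yb) (proj₂ (apart-b p ox xa))
      adjacentEnds-odd 1 A xa yb _ _ =
        ⊥-elim (noSquare (Outside.≢b ox) (≢-sym (Outside.≢a oy)) xa ab (~-sym yb) (~-sym (arc₁ A)))
      adjacentEnds-odd 2 A xa yb _ _ =
        ⊥-elim (Outside.≢c oy (unique
          (_ , _ , pentagon ab (~-sym yb)
             (subst (_~ Arc.at A 1) (Arc.end A) (~-sym (InducedPath.link (Arc.path A) 1 (s≤s z<s))))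
             (subst (Arc.at A 1 ~_) (Arc.start A) (~-sym (InducedPath.link (Arc.path A) 0 z<s)))
             xa)
          (_ , _ , p)))
      adjacentEnds-odd 3 _ _ _ _ _ = refl , ≤-refl
      adjacentEnds-odd m@(suc (suc (suc (suc k)))) A xa yb a# b# =
        suc-even m (longHole-even (3 + m) (7≤7+ k) hole) , s≤s (s≤s (s≤s z≤n))
        where
        hole : Hole G (3 + m)
        hole = closeHole (prepend A (~-sym xa) (apart-e (rotate p) (rotateOut oy) yb) a#)
                 (s≤s (s≤s z≤n)) (~-sym ab) (~-sym yb)
                 λ { (inj₁ refl) → apart-b p ox xa ; (inj₂ Pz) → b# Pz }

      -- The closure runs through `a b c` and has length `m + 4`, so interior vertices may still be
      -- adjacent to `d` or `e`. For `m = 1` it is the pentagon `b a x y c`, and `unique` on the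
      -- edge `b a` would force `x ≡ e`.
      shortWay-even : ∀ m → Arc P x y m → x ~ a → y ~ c →
        (∀ {z} → P z → Apart a z) → (∀ {z} → P z → Apart b z) → (∀ {z} → P z → Apart c z) →
        parity m ≡ 0ℙ
      shortWay-even 0 _ _ _ _ _ _ = refl
      shortWay-even 1 A xa yc _ _ _ =
        ⊥-elim (Outside.≢e ox (unique
          (_ , _ , pentagon (~-sym ab) (~-sym xa) (arc₁ A) yc (~-sym bc))
          (_ , _ , reflect (rotate p))))
      shortWay-even 2 _ _ _ _ _ _ = refl
      shortWay-even m@(suc (suc (suc k))) A xa yc a# b# c# =
        longHole-even (4 + m) (7≤7+ k) hole
        where
        oy′ = rotateOut (rotateOut oy)
        p′ = rotate (rotate p)
        hole : Hole G (4 + m)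
        hole = closeHole
          (prepend (prepend A (~-sym xa) (apart-d p′ oy′ yc) a#) (~-sym ab) (apart-e p′ oy′ yc)
            λ { (inj₁ refl) → apart-b p ox xa ; (inj₂ Pz) → b# Pz })
          (s≤s (s≤s z≤n)) (~-sym bc) (~-sym yc)
          λ { (inj₁ refl) → Apart-sym (diagonal p)
            ; (inj₂ (inj₁ refl)) → apart-c p ox xa
            ; (inj₂ (inj₂ Pz)) → c# Pz }

      -- The closure runs through `a e d c` and has length `m + 5`; this side of the pentagon is one
      -- edge longer, so the parity flips. Interior vertices may be adjacent to `b`.
      longWay-odd : ∀ m → Arc P x y m → x ~ a → y ~ c →
        (∀ {z} → P z → Apart a z) → (∀ {z} → P z → Apart c z) →
        (∀ {z} → P z → Apart d z) → (∀ {z} → P z → Apart e z) → parity m ≡ 1ℙ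
      longWay-odd 0 A xa yc _ _ _ _ with arc₀ A
      ... | refl = contradiction (~-sym yc) (proj₂ (apart-c p ox xa))
      longWay-odd 1 _ _ _ _ _ _ _ = refl
      longWay-odd m@(suc (suc k)) A xa yc a# c# d# e# =
        suc-even m (longHole-even (5 + m) (7≤7+ k) hole)
        where
        oy′ = rotateOut (rotateOut oy)
        p′ = rotate (rotate p)
        hole : Hole G (5 + m)
        hole = closeHole
          (prepend
            (prepend (prepend A (~-sym xa) (apart-d p′ oy′ yc) a#) ea (apart-c p′ oy′ yc)
              λ { (inj₁ refl) → apart-e p ox xa ; (inj₂ Pz) → e# Pz })
            de (apart-b p′ oy′ yc)
            λ { (inj₁ refl) → diagonal (rotate (rotate (rotate p)))
              ; (inj₂ (inj₁ refl)) → apart-d p ox xa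
              ; (inj₂ (inj₂ Pz)) → d# Pz })
          (s≤s (s≤s z≤n)) cd (~-sym yc)
          λ { (inj₁ refl) → diagonal p′
            ; (inj₂ (inj₁ refl)) → Apart-sym (diagonal p)
            ; (inj₂ (inj₂ (inj₁ refl))) → apart-c p ox xa
            ; (inj₂ (inj₂ (inj₂ Pz))) → c# Pz }

    odd-∸ : ∀ {i k} → i ≤ k → parity (k ∸ i) ≡ 1ℙ → parity k ≡ parity i ⁻¹
    odd-∸ {i} i≤k odd = trans (parity-∸ i≤k) (cong (ℙ._+ parity i) odd)

    even-∸ : ∀ {i k} → i ≤ k → parity (k ∸ i) ≡ 0ℙ → parity k ≡ parity i
    even-∸ {i} i≤k even = trans (parity-∸ i≤k) (cong (ℙ._+ parity i) even)

    0ℙ≢1ℙ : ∀ {q} → q ≡ 0ℙ → q ≡ 1ℙ → ⊥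
    0ℙ≢1ℙ refl ()

    -- Scanning the labels along a crossing path.

    module _ {a b c d e : V} (p : Pentagon a b c d e) (f : ℕ → V) (m : ℕ)
             (F : InducedPath f m)
             (out : ∀ t → t ≤ m → Outside a b c d e (f t))
             (start : f 0 ~ a) (end : f m ~ c)
             (no-a : ∀ t → 0 < t → t ≤ m → ¬ f t ~ a)
             (no-b : ∀ t → t ≤ m → ¬ f t ~ b)
             (no-c : ∀ t → t < m → ¬ f t ~ c)
             where

      -- Call f t labelled by its neighbour on the pentagon, if any. After scanning
      -- f 0, …, f j, the last labelled position is i, and o is the last labelled position
      -- whose label differs from that of i. The invariant is that an e-run is left at an
      -- even position, a d-run at an odd one.
      data State (j : ℕ) : Set where
        unlabelled : (∀ t → 0 < t → t ≤ j → ¬ f t ~ d) → (∀ t → 0 < t → t ≤ j → ¬ f t ~ e) → State j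
        run-e : ∀ o i → o < i → i ≤ j → o ≡ 0 ⊎ (f o ~ d × parity o ≡ 1ℙ) → f i ~ e →
                (∀ t → o < t → t ≤ j → ¬ f t ~ d) → (∀ t → i < t → t ≤ j → ¬ f t ~ e) → State j
        run-d : ∀ o i → o < i → i ≤ j → f o ~ e × parity o ≡ 0ℙ → f i ~ d →
                (∀ t → o < t → t ≤ j → ¬ f t ~ e) → (∀ t → i < t → t ≤ j → ¬ f t ~ d) → State j

      Free : V → Set
      Free z = Outside a b c d e z × ¬ z ~ a × ¬ z ~ b × ¬ z ~ c

      free : ∀ t → 0 < t → t < m → Free (f t)
      free t 0<t t<m = out t (<⇒≤ t<m) , no-a t 0<t (<⇒≤ t<m) , no-b t (<⇒≤ t<m) , no-c t t<m

      between : ∀ {Q : V → Set} {i k} → i ≤ k → k ≤ m → (∀ t → i < t → t < k → Q (f t)) →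
                Arc (λ z → Free z × Q z) (f i) (f k) (k ∸ i)
      between i≤k k≤m Q = subarc F i≤k k≤m λ t i<t t<k →
        free t (≤-<-trans z≤n i<t) (<-≤-trans t<k k≤m) , Q t i<t t<k

      clean : ∀ {i k} → i ≤ k → k ≤ m → (∀ t → i < t → t < k → ¬ f t ~ d) →
              (∀ t → i < t → t < k → ¬ f t ~ e) →
              Arc (λ z → Free z × ¬ z ~ d × ¬ z ~ e) (f i) (f k) (k ∸ i)
      clean i≤k k≤m nd ne = between i≤k k≤m λ t i<t t<k → nd t i<t t<k , ne t i<t t<k

      #a : ∀ {z} → Free z → Apart a z
      #a (o , ≁a , _) = apart (Outside.≢a o) ≁a
      #b : ∀ {z} → Free z → Apart b z
      #b (o , _ , ≁b , _) = apart (Outside.≢b o) ≁b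
      #c : ∀ {z} → Free z → Apart c z
      #c (o , _ , _ , ≁c) = apart (Outside.≢c o) ≁c
      #d : ∀ {z} → Free z → ¬ z ~ d → Apart d z
      #d (o , _) = apart (Outside.≢d o)
      #e : ∀ {z} → Free z → ¬ z ~ e → Apart e z
      #e (o , _) = apart (Outside.≢e o)

      -- Read backwards from `e`, so that `e`, `d`, `c` play the roles of `a`, `b`, `c` in the
      -- parity lemmas.
      p-ecba = rotate (reflect p)

      o-ecba : ∀ {x} → Outside a b c d e x → Outside e d c b a x
      o-ecba o = rotateOut (reflectOut o)

      -- With no labels inside, both ways round the pentagon are available and demand opposite
      -- parities. This and the next two lemmas exclude a path with neither `d` nor `e`, a label `d`
      -- directly after the initial `a`, and a label `e` directly before the final `c`.
      unlabelled-ac : ∀ {k} → k ≤ m → f k ~ c → (∀ t → 0 < t → t < k → ¬ f t ~ d) →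
                      (∀ t → 0 < t → t < k → ¬ f t ~ e) → ⊥
      unlabelled-ac {k} k≤m kc nd ne = 0ℙ≢1ℙ
        (shortWay-even p (out 0 z≤n) (out k k≤m) k A start kc (#a ∘ proj₁) (#b ∘ proj₁) (#c ∘ proj₁))
        (longWay-odd p (out 0 z≤n) (out k k≤m) k A start kc (#a ∘ proj₁) (#c ∘ proj₁)
          (λ (r , ≁d , _) → #d r ≁d) (λ (r , _ , ≁e) → #e r ≁e))
        where A = clean z≤n k≤m nd ne

      unlabelled-ad : ∀ {k} → k ≤ m → f k ~ d → (∀ t → 0 < t → t < k → ¬ f t ~ d) →
                      (∀ t → 0 < t → t < k → ¬ f t ~ e) → ⊥
      unlabelled-ad {k} k≤m kd nd ne = 0ℙ≢1ℙ
        (shortWay-even (reflect p) (reflectOut (out 0 z≤n)) (reflectOut (out k k≤m)) k A start kd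
          (#a ∘ proj₁) (λ (r , _ , ≁e) → #e r ≁e) (λ (r , ≁d , _) → #d r ≁d))
        (longWay-odd (reflect p) (reflectOut (out 0 z≤n)) (reflectOut (out k k≤m)) k A start kd
          (#a ∘ proj₁) (λ (r , ≁d , _) → #d r ≁d) (#c ∘ proj₁) (#b ∘ proj₁))
        where A = clean z≤n k≤m nd ne

      unlabelled-ec : ∀ {i k} → i ≤ k → k ≤ m → f i ~ e → f k ~ c →
                      (∀ t → i < t → t < k → ¬ f t ~ d) →
                      (∀ t → i < t → t < k → ¬ f t ~ e) → ⊥
      unlabelled-ec {i} {k} i≤k k≤m ie kc nd ne = 0ℙ≢1ℙ
        (shortWay-even p-ecba oi ok (k ∸ i) A ie kc
          (λ (r , _ , ≁e) → #e r ≁e) (λ (r , ≁d , _) → #d r ≁d) (#c ∘ proj₁))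
        (longWay-odd p-ecba oi ok (k ∸ i) A ie kc
          (λ (r , _ , ≁e) → #e r ≁e) (#c ∘ proj₁) (#b ∘ proj₁) (#a ∘ proj₁))
        where
        A = clean i≤k k≤m nd ne
        oi = o-ecba (out i (≤-trans i≤k k≤m))
        ok = o-ecba (out k k≤m)

      clean-ed : ∀ {i k} → i ≤ k → k ≤ m → f i ~ e → f k ~ d →
                 (∀ t → i < t → t < k → ¬ f t ~ d) → (∀ t → i < t → t < k → ¬ f t ~ e) →
                 parity (k ∸ i) ≡ 1ℙ × 3 ≤ k ∸ i
      clean-ed {i} {k} i≤k k≤m ie kd nd ne =
        adjacentEnds-odd p-ecba (o-ecba (out i (≤-trans i≤k k≤m))) (o-ecba (out k k≤m)) (k ∸ i)
          (clean i≤k k≤m nd ne) ie kd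
          (λ (r , _ , ≁e) → #e r ≁e) (λ (r , ≁d , _) → #d r ≁d)

      clean-de : ∀ {i k} → i ≤ k → k ≤ m → f i ~ d → f k ~ e →
                 (∀ t → i < t → t < k → ¬ f t ~ d) → (∀ t → i < t → t < k → ¬ f t ~ e) →
                 parity (k ∸ i) ≡ 1ℙ × 3 ≤ k ∸ i
      clean-de {i} {k} i≤k k≤m id ke nd ne =
        adjacentEnds-odd (rotate (rotate (rotate p)))
          (rotateOut (rotateOut (rotateOut (out i (≤-trans i≤k k≤m)))))
          (rotateOut (rotateOut (rotateOut (out k k≤m)))) (k ∸ i)
          (clean i≤k k≤m nd ne) id ke
          (λ (r , ≁d , _) → #d r ≁d) (λ (r , _ , ≁e) → #e r ≁e)

      longer : ∀ {o i k} → o < i → i ≤ k → 3 ≤ k ∸ i → 4 ≤ k ∸ o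
      longer o<i i≤k 3≤ = ≤-<-trans 3≤ (ℕ.∸-monoʳ-< o<i i≤k)

      finish : ∀ {j} → State j → suc j ≤ m → f (suc j) ~ c → ⊥
      finish (unlabelled nd ne) k≤m kc =
        unlabelled-ac k≤m kc (below nd) (below ne)
      finish (run-e o i o<i i≤j _ ie nd ne) k≤m kc =
        unlabelled-ec (m≤n⇒m≤1+n i≤j) k≤m ie kc
          (λ t → below nd t ∘ <-trans o<i) (below ne)
      -- The last `e` is at the even position `o`. From there on the path closes through `e a b c`,
      -- whatever labels `d` it carries, so that stretch is odd; but the whole path closes through
      -- `a b c` and is even.
      finish {j} (run-d o i o<i i≤j (oe , o-even) id ne nd) k≤m kc = 0ℙ≢1ℙ
        (shortWay-even p (out 0 z≤n) (out (suc j) k≤m) (suc j)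
          (between {λ _ → f 0 ~ a} z≤n k≤m (λ _ _ _ → start)) start kc (#a ∘ proj₁) (#b ∘ proj₁) (#c ∘ proj₁))
        (trans (odd-∸ o≤k (longWay-odd p-ecba
                 (o-ecba (out o (≤-trans o≤k k≤m))) (o-ecba (out (suc j) k≤m))
                 (suc j ∸ o) (between {¬_ ∘ (_~ e)} o≤k k≤m (below ne)) oe kc
                 (λ (r , ≁e) → #e r ≁e) (#c ∘ proj₁) (#b ∘ proj₁) (#a ∘ proj₁)))
               (cong _⁻¹ o-even))
        where
        o≤k : o ≤ suc j
        o≤k = m≤n⇒m≤1+n (≤-trans (<⇒≤ o<i) i≤j)

      d⇒¬e : ∀ {k} → f k ~ d → ¬ f k ~ e
      d⇒¬e kd ke = noTriangle kd (Pentagon.de p) (~-sym ke)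

      -- Between `o` and `k` there may be labels `e` but no `d`. If `o` is the start, the stretch
      -- closes the long way through `a b c d`; if `o` carries `d`, it closes through `d` alone and
      -- `k` inherits the parity of `o`.
      parity-at-d : ∀ {o i k} → o < i → i ≤ k → k ≤ m → o ≡ 0 ⊎ (f o ~ d × parity o ≡ 1ℙ) →
                    3 ≤ k ∸ i → f k ~ d → (∀ t → o < t → t < k → ¬ f t ~ d) → parity k ≡ 1ℙ
      parity-at-d {k = k} o<i i≤k k≤m (inj₁ refl) _ kd nd =
        longWay-odd (reflect p) (reflectOut (out 0 z≤n)) (reflectOut (out k k≤m)) k
          (between {¬_ ∘ (_~ d)} z≤n k≤m nd) start kd
          (#a ∘ proj₁) (λ (r , ≁d) → #d r ≁d) (#c ∘ proj₁) (#b ∘ proj₁)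
      parity-at-d {o} {i} {k} o<i i≤k k≤m (inj₂ (od , o-odd)) 3≤ kd nd =
        trans (even-∸ o≤k (sameEnds-even (k ∸ o) (longer o<i i≤k 3≤)
                (between {¬_ ∘ (_~ d)} o≤k k≤m nd) od kd
                (λ (r , ≁d) → #d r ≁d))) o-odd
        where o≤k = ≤-trans (<⇒≤ o<i) i≤k

      ⁻¹-swap : ∀ {q r} → q ≡ r ⁻¹ → r ≡ q ⁻¹
      ⁻¹-swap {r = 0ℙ} refl = refl
      ⁻¹-swap {r = 1ℙ} refl = refl

      advance : ∀ {j} → State j → suc j ≤ m → State (suc j)
      advance {j} s k≤m with f (suc j) ~? d | f (suc j) ~? e
      advance (unlabelled nd ne) k≤m | no ¬kd | no ¬ke = unlabelled (extend nd ¬kd) (extend ne ¬ke)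
      advance (run-e o i o<i i≤j l ie nd ne) k≤m | no ¬kd | no ¬ke =
        run-e o i o<i (m≤n⇒m≤1+n i≤j) l ie (extend nd ¬kd) (extend ne ¬ke)
      advance (run-d o i o<i i≤j l id ne nd) k≤m | no ¬kd | no ¬ke =
        run-d o i o<i (m≤n⇒m≤1+n i≤j) l id (extend ne ¬ke) (extend nd ¬kd)
      advance (unlabelled nd ne) k≤m | yes kd | _ =
        ⊥-elim (unlabelled-ad k≤m kd (below nd) (below ne))
      -- Position `suc j` is odd by `parity-at-d`, and the label-free gap from `i` is odd, so the
      -- `e`-run is left at an even `i`, which becomes the new `o`.
      advance {j} (run-e o i o<i i≤j l ie nd ne) k≤m | yes kd | _ =
        run-d i (suc j) (s≤s i≤j) ≤-refl (ie , i-even) kd (extend ne (d⇒¬e kd))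
          (λ t k<t t≤k _ → ℕ.<⇒≱ k<t t≤k)
        where
        i≤k = m≤n⇒m≤1+n i≤j
        gap = clean-ed i≤k k≤m ie kd
          (λ t → below nd t ∘ <-trans o<i) (below ne)
        i-even : parity i ≡ 0ℙ
        i-even = trans (⁻¹-swap (odd-∸ i≤k (proj₁ gap)))
          (cong _⁻¹ (parity-at-d o<i i≤k k≤m l (proj₂ gap) kd (below nd)))
      advance {j} (run-d o i o<i i≤j l id ne nd) k≤m | yes kd | _ =
        run-d o (suc j) (m≤n⇒m≤1+n (<-≤-trans o<i i≤j)) ≤-refl l kd (extend ne (d⇒¬e kd))
          (λ t k<t t≤k _ → ℕ.<⇒≱ k<t t≤k)
      advance {j} (unlabelled nd ne) k≤m | no ¬kd | yes ke =
        run-e 0 (suc j) z<s ≤-refl (inj₁ refl) ke (extend nd ¬kd)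
          (λ t k<t t≤k _ → ℕ.<⇒≱ k<t t≤k)
      advance {j} (run-e o i o<i i≤j l ie nd ne) k≤m | no ¬kd | yes ke =
        run-e o (suc j) (m≤n⇒m≤1+n (<-≤-trans o<i i≤j)) ≤-refl l ke (extend nd ¬kd)
          (λ t k<t t≤k _ → ℕ.<⇒≱ k<t t≤k)
      -- Both `o` and `suc j` carry `e` with none between, so `suc j` is even like `o`; the odd gap
      -- from `i` then makes `i` odd.
      advance {j} (run-d o i o<i i≤j (oe , o-even) id ne nd) k≤m | no ¬kd | yes ke =
        run-e i (suc j) (s≤s i≤j) ≤-refl (inj₂ (id , i-odd)) ke (extend nd ¬kd)
          (λ t k<t t≤k _ → ℕ.<⇒≱ k<t t≤k)
        where
        i≤k = m≤n⇒m≤1+n i≤j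
        o≤k = ≤-trans (<⇒≤ o<i) i≤k
        gap = clean-de i≤k k≤m id ke
          (below nd) (λ t → below ne t ∘ <-trans o<i)
        k-even : parity (suc j) ≡ 0ℙ
        k-even = trans (even-∸ o≤k (sameEnds-even (suc j ∸ o) (longer o<i i≤k (proj₂ gap))
          (between {¬_ ∘ (_~ e)} o≤k k≤m (below ne)) oe ke (λ (r , ≁e) → #e r ≁e))) o-even
        i-odd : parity i ≡ 1ℙ
        i-odd = trans (⁻¹-swap (odd-∸ i≤k (proj₁ gap))) (cong _⁻¹ k-even)

      -- Here `r` counts the positions after `j` and before `m`; position `m`, the one labelled `c`,
      -- is left to `finish`.
      scan : ∀ r {j} → suc j + r ≡ m → State j → ⊥
      scan zero {j} eq s = finish s (≤-reflexive k≡m) (subst (λ t → f t ~ c) (sym k≡m) end)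
        where k≡m = trans (sym (ℕ.+-identityʳ (suc j))) eq
      scan (suc r) {j} eq s =
        scan r (trans (sym (+-suc (suc j) r)) eq)
          (advance s (≤-trans (ℕ.m≤m+n (suc j) (suc r)) (≤-reflexive eq)))

      noCrossing : ⊥
      noCrossing = go m refl
        where
        go : ∀ r → r ≡ m → ⊥
        go zero    refl = proj₂ (apart-c p (out 0 z≤n) start) (~-sym end)
        go (suc r) eq   = scan r eq (unlabelled (λ { _ () z≤n }) (λ { _ () z≤n }))

    separation : ∀ {a b c d e x y} → Pentagon a b c d e → x ~ a → y ~ c →
                 Walk (λ z → Outside a b c d e z × ¬ z ~ b) x y → ⊥
    separation {a} {c = c} p xa yc w with shorten w
    ... | record { len = m ; at = f ; path = F ; start = refl ; end = refl ; within = inP }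
      -- Keeping only the stretch from the last neighbour of `a` to the first neighbour of `c` after
      -- it provides `no-a` and `no-c` for `noCrossing`.
      with last (λ t → f t ~? a) m xa
    ...   | i , i≤m , fi~a , after
      with first (λ t → f (t + i) ~? c) (m ∸ i) (subst (λ t → f t ~ c) (sym (m∸n+n≡m i≤m)) yc)
    ...     | k , k≤ , fk~c , before =
      noCrossing p (λ t → f (t + i)) k (truncate k≤ (drop i≤m F))
        (λ t t≤k → proj₁ (inP′ t t≤k)) fi~a fk~c
        (λ t 0<t t≤k → after (t + i) (+-monoˡ-< i 0<t) (∸-bound i≤m (≤-trans t≤k k≤)))
        (λ t t≤k → proj₂ (inP′ t t≤k)) before
      where inP′ = λ t t≤k → inP (t + i) (∸-bound i≤m (≤-trans t≤k k≤))

    -- Walks off the pentagon supplied by connectivity.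

    module _ (three : ∀ (X : Subset n) → ∣ X ∣ < 3 → ConnectedWithout G X)
             (stable : ∀ (S : Subset n) → ThreeCutset G S → Stable G S) where

      triple : V → V → V → Subset n
      triple a b c = ⁅ a ⁆ ∪ (⁅ b ⁆ ∪ ⁅ c ⁆)

      pair-size : ∀ {a b : V} → a ≢ b → ∣ ⁅ a ⁆ ∪ ⁅ b ⁆ ∣ ≡ 2
      pair-size {b = b} a≢b =
        trans (∣⁅x⁆∪p∣ ⁅ b ⁆ (a≢b ∘ x∈⁅y⁆⇒x≡y b)) (cong suc (∣⁅x⁆∣≡1 b))

      ∉-pair : ∀ {a b x : V} → x ≢ a → x ≢ b → x ∉ ⁅ a ⁆ ∪ ⁅ b ⁆
      ∉-pair {a} {b} x≢a x≢b x∈ with x∈p∪q⁻ ⁅ a ⁆ ⁅ b ⁆ x∈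
      ... | inj₁ x∈a = x≢a (x∈⁅y⁆⇒x≡y a x∈a)
      ... | inj₂ x∈b = x≢b (x∈⁅y⁆⇒x≡y b x∈b)

      ∉-triple : ∀ {a b c x} → x ≢ a → x ≢ b → x ≢ c → x ∉ triple a b c
      ∉-triple {a} {b} {c} x≢a x≢b x≢c x∈ with x∈p∪q⁻ ⁅ a ⁆ (⁅ b ⁆ ∪ ⁅ c ⁆) x∈
      ... | inj₁ x∈a  = x≢a (x∈⁅y⁆⇒x≡y a x∈a)
      ... | inj₂ x∈bc = ∉-pair x≢b x≢c x∈bc

      ∉-triple⁻ : ∀ {a b c x} → x ∉ triple a b c → x ≢ a × x ≢ b × x ≢ c
      ∉-triple⁻ {x = x} x∉ =
        (λ { refl → x∉ (x∈p∪q⁺ (inj₁ (x∈⁅x⁆ x))) }) ,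
        (λ { refl → x∉ (x∈p∪q⁺ (inj₂ (x∈p∪q⁺ (inj₁ (x∈⁅x⁆ x))))) }) ,
        (λ { refl → x∉ (x∈p∪q⁺ (inj₂ (x∈p∪q⁺ (inj₂ (x∈⁅x⁆ x))))) })

      -- If its removal disconnected `G`, this set of size 3 would have to be stable, yet it
      -- contains the edge `a b`. The double negation suffices because it is only used to derive
      -- `⊥`.
      path-not-cutset : ∀ {a b c} → a ~ b → b ~ c → a ≢ c → ¬ ¬ ConnectedWithout G (triple a b c)
      path-not-cutset {a} {b} {c} ab bc a≢c disconnected =
        stable (triple a b c) (size , disconnected) a b
          (x∈p∪q⁺ (inj₁ (x∈⁅x⁆ a))) (x∈p∪q⁺ (inj₂ (x∈p∪q⁺ (inj₁ (x∈⁅x⁆ b))))) ab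
        where
        size : ∣ triple a b c ∣ ≡ 3
        size = trans (∣⁅x⁆∪p∣ (⁅ b ⁆ ∪ ⁅ c ⁆) (∉-pair (~⇒≢ ab) a≢c))
                     (cong suc (pair-size (~⇒≢ bc)))

      source∉ : ∀ {X u v} → WalkAvoiding G X u v → u ∉ X
      source∉ (here u∉)     = u∉
      source∉ (step u∉ _ _) = u∉

      -- The walk is cut at its first vertex adjacent to `d` or `e`. Up to there it enters neither
      -- `d` nor `e`, as the preceding vertex would already qualify, and it avoids `a`, `b`, `c` by
      -- hypothesis.
      toNeighbour : ∀ {a b c d e x} → Outside a b c d e x →
        WalkAvoiding G (triple a b c) x d →
        ∃ λ v → (v ~ d ⊎ v ~ e) ×
                Walk (λ z → Outside a b c d e z × (z ~ d ⊎ z ~ e → z ≡ v)) x v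
      toNeighbour o (here _) = contradiction refl (Outside.≢d o)
      toNeighbour {a} {b} {c} {d} {e} o (step {u} _ u~v w) with (u ~? d) ⊎-dec (u ~? e)
      ... | yes near = u , near , here (o , λ _ → refl)
      ... | no ¬near with ∉-triple⁻ (source∉ w)
      ...   | ≢a , ≢b , ≢c
        with toNeighbour (out ≢a ≢b ≢c (λ { refl → ¬near (inj₁ u~v) }) (λ { refl → ¬near (inj₂ u~v) })) w
      ...     | v , v~ , w′ = v , v~ , step (o , ⊥-elim ∘ ¬near) u~v w′

      -- Deleting `a b c` leaves `x` connected to `d`, so `toNeighbour` applies. Its end is adjacent
      -- to just one of `d` and `e`, lest there be a triangle, so the walk misses all neighbours of
      -- the other. The outcomes are passed as refutations since connectivity is known only up to
      -- double negation.
      escape : ∀ {a b c d e x} → Pentagon a b c d e → Outside a b c d e x →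
        (∀ {v} → v ~ d → Walk (λ z → Outside a b c d e z × ¬ z ~ e) x v → ⊥) →
        (∀ {v} → v ~ e → Walk (λ z → Outside a b c d e z × ¬ z ~ d) x v → ⊥) → ⊥
      escape {a} {b} {c} {d} {e} {x} p o to-d to-e =
        path-not-cutset (Pentagon.ab p) (Pentagon.bc p) (proj₁ (diagonal p)) connected⇒⊥
        where
        not-both : ∀ {z} → z ~ d → z ~ e → ⊥
        not-both zd ze = noTriangle zd (Pentagon.de p) (~-sym ze)
        connected⇒⊥ : ConnectedWithout G (triple a b c) → ⊥
        connected⇒⊥ connected with toNeighbour o (connected x d
            (∉-triple (Outside.≢a o) (Outside.≢b o) (Outside.≢c o))
            (∉-triple (proj₁ (diagonal (rotate (rotate (rotate p)))))
                      (≢-sym (proj₁ (diagonal (rotate p)))) (≢-sym (~⇒≢ (Pentagon.cd p)))))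
        ... | v , inj₁ vd , w = to-d vd (mapWalk (λ (oz , only) →
                oz , λ ze → not-both (subst (_~ d) (sym (only (inj₂ ze))) vd) ze) w)
        ... | v , inj₂ ve , w = to-e ve (mapWalk (λ (oz , only) →
                oz , λ zd → not-both zd (subst (_~ e) (sym (only (inj₁ zd))) ve)) w)

      -- Deleting `b` and `e` leaves a walk from `a` to `c`. Its first step leaves the pentagon, as
      -- `c` and `d` are not adjacent to `a`.
      neighbourOutside : ∀ {a b c d e} → Pentagon a b c d e → ∃ λ u → u ~ a × Outside a b c d e u
      neighbourOutside {a} {b} {c} {d} {e} p
        with three (⁅ b ⁆ ∪ ⁅ e ⁆) (s≤s (≤-reflexive (pair-size b≢e))) a c
               (∉-pair (~⇒≢ (Pentagon.ab p)) (≢-sym (~⇒≢ (Pentagon.ea p))))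
               (∉-pair (≢-sym (~⇒≢ (Pentagon.bc p))) (proj₁ (diagonal (rotate (rotate p)))))
        where b≢e = proj₁ (diagonal (reflect (rotate p)))
      ... | here _ = contradiction refl (proj₁ (diagonal p))
      ... | step {v = u} _ au w = u , ~-sym au , out
              (≢-sym (~⇒≢ au))
              (λ { refl → source∉ w (x∈p∪q⁺ (inj₁ (x∈⁅x⁆ u))) })
              (λ { refl → proj₂ (diagonal p) au })
              (λ { refl → proj₂ (diagonal (reflect p)) au })
              (λ { refl → source∉ w (x∈p∪q⁺ (inj₂ (x∈⁅x⁆ u))) })

      -- If the walk meets a neighbour of `e`, its remainder contradicts separation for `e d c`.
      -- Otherwise it is continued from `v` by `escape`: reaching `d` contradicts separation for
      -- `a e d`, and reaching `e` does so for `c d e`.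
      noWalk-ac : ∀ {a b c d e u v} → Pentagon a b c d e → u ~ a → v ~ c →
                  Walk (λ z → Outside a b c d e z × ¬ z ~ d) u v → ⊥
      noWalk-ac {e = e} p ua vc w with avoidOrMeet (_~? e) w
      ... | inj₂ (z , ze , w′) = separation (rotate (reflect p)) ze vc
              (mapWalk (λ (o , ≁d) → rotateOut (reflectOut o) , ≁d) w′)
      ... | inj₁ w₀ = escape p (proj₁ (endpoint w))
              (λ v′d w₁ → separation (reflect p) ua v′d
                (mapWalk (λ (o , ≁e) → reflectOut o , ≁e)
                  (append (mapWalk (λ ((o , _) , ≁e) → o , ≁e) w₀) w₁)))
              (λ v′e w₁ → separation (rotate (rotate p)) vc v′e
                (mapWalk (λ (o , ≁d) → rotateOut (rotateOut o) , ≁d) w₁))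

      noPentagon : ∀ {a b c d e} → ¬ Pentagon a b c d e
      noPentagon p with neighbourOutside p
      -- Rotated four times the pentagon reads `e a b c d`: the deleted path is centred at `a`, and
      -- the walk leads to a neighbour of `c` or `d`. These outcomes are mirror images.
      ... | u , ua , o = escape (rotate (rotate (rotate (rotate p))))
              (rotateOut (rotateOut (rotateOut (rotateOut o))))
              (λ vc w → noWalk-ac p ua vc (mapWalk (λ (o , ≁d) → rotateOut o , ≁d) w))
              (λ vd w → noWalk-ac (reflect p) ua vd
                (mapWalk (λ (o , ≁c) → reflectOut (rotateOut o) , ≁c) w))

theorem1p5 : (n : ℕ) (G : Graph n) →
    ThreeConnected G → InG2 G → Cycle G 5 →
    (∀ (S : Subset n) → ThreeCutset G S → Stable G S) →
    TwoFiveCyclesSharingEdge G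
theorem1p5 n G (_ , three) ((_ , girth) , noLong) C stable with Pentagons.twoTurns? G girth
... | yes two = Pentagons.twoTurns⇒sharing G girth two
... | no ¬two = ⊥-elim (noPentagon three stable (fromCycle C))
  where
  open Pentagons G girth
  unique : ∀ {a b c c′} → Turn a b c → Turn a b c′ → c ≡ c′
  unique {c = c} {c′} t t′ with c ≟ c′
  ... | yes c≡c′ = c≡c′
  ... | no c≢c′  = ⊥-elim (¬two (_ , _ , c , c′ , t , t′ , c≢c′))
  open Parities noLong unique
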